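{- Let $i,j\in\mathbb{Z}$ with $|i|\ge |j|$. The number $f_8(i,j)$ of shortest paths from the origin $q=(0,0)$ to the point $p=(i,j)$ in the 8-neighborhood of the 2D square grid $\mathbb{Z}^2$ is $$f_8(i,j)=\sum_{\substack{b\ge 0\\ 2b\le |i|-|j|}}\frac{|i|!}{b!\,(|j|+b)!\,(|i|-|j|-2b)!},$$ where the sum is over integers $b$.
   Context: In the square grid $\mathbb{Z}^2$, the 8-neighborhood (chessboard neighborhood) of a point $(x,y)$ consists of the points $(x',y')\in\mathbb{Z}^2$ with $\max\{|x-x'|,|y-y'|\}\le 1$ (horizontal, vertical and diagonal moves are allowed). A path of length $n$ from $q$ to $p$ in the 8-neighborhood is a sequence of points $q=r_0,r_1,\dots,r_n=p$ of $\mathbb{Z}^2$ with $r_{t+1}$ in the 8-neighborhood of $r_t$ for $0\le t<n$. A shortest path is a path of minimal length among all such paths from $q$ to $p$; two paths are distinct if they differ as sequences of points. -}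

module Defs where

open import Data.Fin using (Fin; zero; suc; inject₁; fromℕ)
open import Data.Integer using (ℤ; +_; ∣_∣; _-_)
open import Data.List using (List; filter; foldr; map; upTo)
open import Data.Nat using (ℕ; suc; _+_; _*_; _∸_; _⊔_; _≤_; _≤?_; _!)
open import Data.Nat.Properties using (m*n≢0; _!≢0)
open import Data.Product using (Σ; Σ-syntax; _×_; _,_; proj₁)
open import Data.Rational using (ℚ; 0ℚ; _/_)
import Data.Rational as ℚ
open import Data.Vec using (Vec; lookup)
open import Function.Bundles using (Inverse)
open import Level using (0ℓ)
open import Relation.Binary.Bundles using (Setoid)
open import Relation.Binary.Construct.On using () renaming (setoid to onSetoid)
open import Relation.Binary.PropositionalEquality using (_≡_; setoid)

Point : Set
Point = ℤ × ℤ

infix 4 _∈N₈_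

_∈N₈_ : Point → Point → Set
(x′ , y′) ∈N₈ (x , y) = ∣ x - x′ ∣ ⊔ ∣ y - y′ ∣ ≤ 1

-- A path of length n visits n + 1 points r₀, …, rₙ.
record IsPath (q p : Point) {n : ℕ} (r : Vec Point (suc n)) : Set where
  field
    start : lookup r zero ≡ q
    end   : lookup r (fromℕ n) ≡ p
    step  : (t : Fin n) → lookup r (suc t) ∈N₈ lookup r (inject₁ t)

IsShortestPath : Point → Point → {n : ℕ} → Vec Point (suc n) → Set
IsShortestPath q p {n} r =
  IsPath q p r × (∀ {m} (s : Vec Point (suc m)) → IsPath q p s → n ≤ m)

PointSequence : Set
PointSequence = Σ[ n ∈ ℕ ] Vec Point (suc n)

ShortestPath : Point → Point → Set
ShortestPath q p = Σ[ (n , r) ∈ PointSequence ] IsShortestPath q p r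

-- Two shortest paths are equal when their point sequences are; the proofs of
-- being a shortest path are not compared.
ShortestPaths : Point → Point → Setoid 0ℓ 0ℓ
ShortestPaths q p = onSetoid {B = ShortestPath q p} (setoid PointSequence) proj₁

HasCardinality : Setoid 0ℓ 0ℓ → ℕ → Set
HasCardinality S N = Inverse S (setoid (Fin N))

-- Exact rational division, so that no rounding is involved. The subtraction
-- d ∸ c ∸ 2b is only used for c ≤ d and 2b ≤ d ∸ c.
term : (d c b : ℕ) → ℚ
term d c b = (+ (d !)) / (b ! * (c + b) ! * (d ∸ c ∸ 2 * b) !)
  where
  instance
    _ = b !≢0
    _ = (c + b) !≢0
    _ = (d ∸ c ∸ 2 * b) !≢0
    _ = m*n≢0 (b !) ((c + b) !)
    _ = m*n≢0 (b ! * (c + b) !) ((d ∸ c ∸ 2 * b) !)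

-- The b ≥ 0 with 2b ≤ e; each such b is at most e, hence occurs in upTo (suc e).
indices : ℕ → List ℕ
indices e = filter (λ b → 2 * b ≤? e) (upTo (suc e))

sumℚ : List ℚ → ℚ
sumℚ = foldr ℚ._+_ 0ℚ

f₈-formula : ℤ → ℤ → ℚ
f₈-formula i j = sumℚ (map (term ∣ i ∣ ∣ j ∣) (indices (∣ i ∣ ∸ ∣ j ∣)))

{-# OPTIONS --safe #-}

-- A shortest path to (i , j) takes |i| steps, since a step changes the first
-- coordinate by at most one; hence every step moves it by exactly one towards
-- i.  The second coordinate is free: the path is a word of |i| vertical moves,
-- each directed away from j, neutral or towards j, with total |j|.  With b
-- moves away there are |j| + b moves towards j and |i| - |j| - 2b neutral
-- ones, so the words with this b are counted by a multinomial coefficient.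
module Submission where

open import Defs
open import Algebra.Bundles using (AbelianGroup)
import Algebra.Properties.Group as GroupProperties
open import Data.Empty using (⊥-elim)
open import Data.Fin using (Fin; zero; suc; inject₁; fromℕ)
open import Data.Integer using (ℤ; +_; 0ℤ; 1ℤ; -1ℤ; ∣_∣; _◃_; sign; -[1+_])
import Data.Integer as ℤ
import Data.Integer.Properties as ℤ
import Data.Integer.Tactic.RingSolver as ℤSolver
open import Data.List using (List; []; _∷_; _++_; map; concatMap; length; lookup; upTo)
open import Data.List.Membership.Propositional using (_∈_; lose; find)
open import Data.List.Membership.Propositional.Properties
open import Data.List.Properties using (length-++; length-map)
open import Data.List.Relation.Binary.Disjoint.Propositional using (Disjoint)
open import Data.List.Relation.Unary.All as All using (All; []; _∷_)
import Data.List.Relation.Unary.All.Properties as All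
open import Data.List.Relation.Unary.AllPairs as AllPairs using ([]; _∷_)
import Data.List.Relation.Unary.AllPairs.Properties as AllPairs
open import Data.List.Relation.Unary.Any using (here; there; index)
open import Data.List.Relation.Unary.Any.Properties using (lookup-index)
open import Data.List.Relation.Unary.Unique.Propositional using (Unique)
import Data.List.Relation.Unary.Unique.Propositional.Properties as Unique
open import Data.Nat using (ℕ; zero; suc; _+_; _*_; _∸_; _≤_; _≥_; _≤?_; z≤n; s≤s; _!; NonZero)
open import Data.Nat.Properties
import Data.Nat.Tactic.RingSolver as ℕSolver
open import Data.Product using (Σ-syntax; ∃-syntax; _×_; _,_; proj₁; proj₂; map₁; map₂)
open import Data.Product.Properties using (,-injectiveʳ-UIP)
open import Data.Rational using (ℚ; _/_)
import Data.Rational as ℚ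
import Data.Rational.Properties as ℚ
import Data.Rational.Unnormalised as ℚᵘ
import Data.Rational.Unnormalised.Properties as ℚᵘ
open import Data.Sign using (Sign)
open import Data.Sum using (inj₁; inj₂; [_,_]′)
open import Data.Vec using (Vec; []; _∷_)
import Data.Vec as Vec
open import Data.Vec.Properties using (∷-injective; ∷-injectiveʳ)
open import Function using (_∘_; case_of_)
open import Relation.Binary.Construct.On using () renaming (setoid to onSetoid)
open import Relation.Binary.PropositionalEquality hiding ([_])

private
  module ℤGroup = GroupProperties (AbelianGroup.group ℤ.+-0-abelianGroup)

  variable
    n : ℕ

-- Words of moves and their multinomial count

data Move : Set where
  down level up : Move

-- The numbers of down, up and level moves, in this order.
Tally : Set
Tally = ℕ × ℕ × ℕ

record-move : Move → Tally → Tally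
record-move down  = map₁ suc
record-move up    = map₂ (map₁ suc)
record-move level = map₂ (map₂ suc)

tally : Vec Move n → Tally
tally []      = 0 , 0 , 0
tally (m ∷ w) = record-move m (tally w)

-- A letter with count zero cannot come first. Matching on the count, rather than taking a truncated
-- predecessor, keeps that block empty.
prepend : Move → (ℕ → List (Vec Move n)) → ℕ → List (Vec Move (suc n))
prepend m f zero    = []
prepend m f (suc k) = map (m ∷_) (f k)

-- Splitting by the first letter is the Pascal recurrence for trinomial coefficients. A tally whose
-- entries do not add up to `n` yields the empty list.
words : ∀ n → Tally → List (Vec Move n)
words zero    (zero , zero , zero) = [] ∷ []
words zero    (_ , _ , _)          = []
words (suc n) (b , p , z) =
  prepend down  (λ k → words n (k , p , z)) b ++
  prepend up    (λ k → words n (b , k , z)) p ++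
  prepend level (λ k → words n (b , p , k)) z

-- Completeness of the enumeration; `tally-∈-words` is the soundness.
∈-words-tally : (w : Vec Move n) → w ∈ words n (tally w)
∈-words-tally []          = here refl
∈-words-tally (down ∷ w)  = ∈-++⁺ˡ (∈-map⁺ (down ∷_) (∈-words-tally w))
∈-words-tally {suc n} (up ∷ w) with tally w | ∈-words-tally w
... | b , p , z | w∈ =
  ∈-++⁺ʳ (prepend down (λ k → words n (k , suc p , z)) b) (∈-++⁺ˡ (∈-map⁺ (up ∷_) w∈))
∈-words-tally {suc n} (level ∷ w) with tally w | ∈-words-tally w
... | b , p , z | w∈ =
  ∈-++⁺ʳ (prepend down (λ k → words n (k , p , suc z)) b)
    (∈-++⁺ʳ (prepend up (λ k → words n (b , k , suc z)) p) (∈-map⁺ (level ∷_) w∈))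

∈-prepend⁻ : ∀ {m f v} k → v ∈ prepend {n} m f k →
             ∃[ l ] ∃[ w ] (k ≡ suc l × v ≡ m ∷ w × w ∈ f l)
∈-prepend⁻ {m = m} (suc l) v∈ with w , w∈ , v≡ ← ∈-map⁻ (m ∷_) v∈ = l , w , refl , v≡ , w∈

tally-∈-words : ∀ {n t} {w : Vec Move n} → w ∈ words n t → tally w ≡ t
tally-∈-words {zero} {zero , zero , zero} (here refl) = refl
tally-∈-words {zero} {zero , zero , suc _} ()
tally-∈-words {zero} {zero , suc _ , _} ()
tally-∈-words {zero} {suc _ , _ , _} ()
tally-∈-words {suc n} {b , p , z} w∈
  with ∈-++⁻ (prepend down (λ k → words n (k , p , z)) b) w∈
... | inj₁ w∈d with _ , _ , refl , refl , v∈ ← ∈-prepend⁻ b w∈d =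
  cong (record-move down) (tally-∈-words v∈)
... | inj₂ w∈ul with ∈-++⁻ (prepend up (λ k → words n (b , k , z)) p) w∈ul
...   | inj₁ w∈u with _ , _ , refl , refl , v∈ ← ∈-prepend⁻ p w∈u =
  cong (record-move up) (tally-∈-words v∈)
...   | inj₂ w∈l with _ , _ , refl , refl , v∈ ← ∈-prepend⁻ z w∈l =
  cong (record-move level) (tally-∈-words v∈)

words-disjoint : ∀ {n t t′} → t ≢ t′ → Disjoint (words n t) (words n t′)
words-disjoint t≢t′ (w∈ , w∈′) = t≢t′ (trans (sym (tally-∈-words w∈)) (tally-∈-words w∈′))

prepend-unique : ∀ m {f} k → (∀ l → Unique (f l)) → Unique (prepend {n} m f k)
prepend-unique m zero    uf = []
prepend-unique m (suc k) uf = Unique.map⁺ ∷-injectiveʳ (uf k)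

prepend-disjoint : ∀ {m m′ f g} k l → m ≢ m′ →
                   Disjoint (prepend {n} m f k) (prepend m′ g l)
prepend-disjoint k l m≢m′ (v∈ , v∈′)
  with _ , _ , _ , refl , _ ← ∈-prepend⁻ k v∈
     | _ , _ , _ , v≡   , _ ← ∈-prepend⁻ l v∈′ = m≢m′ (proj₁ (∷-injective v≡))

words-unique : ∀ n t → Unique (words n t)
words-unique zero (zero , zero , zero)  = [] ∷ []
words-unique zero (zero , zero , suc _) = []
words-unique zero (zero , suc _ , _)    = []
words-unique zero (suc _ , _ , _)       = []
words-unique (suc n) (b , p , z) =
  Unique.++⁺ (prepend-unique down b λ _ → words-unique n _)
    (Unique.++⁺ (prepend-unique up p λ _ → words-unique n _)
                (prepend-unique level z λ _ → words-unique n _)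
                (prepend-disjoint p z λ ()))
    λ (v∈d , v∈ul) → case ∈-++⁻ (prepend up (λ k → words n (b , k , z)) p) v∈ul of
      [ (λ v∈u → prepend-disjoint b p (λ ()) (v∈d , v∈u))
      , (λ v∈l → prepend-disjoint b z (λ ()) (v∈d , v∈l)) ]′

-- From `k ! = k * l !` with `k = suc l`, a block contributes `k` times the product known for
-- shorter words. For `k = 0` the block is empty and both sides vanish.
length-prepend : ∀ {n} m {f} k r {t} → (∀ l → k ≡ suc l → length (f l) * (l ! * r) ≡ t) →
                 length (prepend {n} m f k) * (k ! * r) ≡ k * t
length-prepend m zero    r eq = refl
length-prepend m {f} (suc k) r {t} eq = begin
  length (map (m ∷_) (f k)) * (suc k * k ! * r) ≡⟨ cong (_* _) (length-map (m ∷_) (f k)) ⟩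
  length (f k) * (suc k * k ! * r)              ≡⟨ rearrange (length (f k)) (suc k) (k !) r ⟩
  suc k * (length (f k) * (k ! * r))            ≡⟨ cong (suc k *_) (eq k refl) ⟩
  suc k * t                                     ∎
  where
  open ≡-Reasoning
  rearrange : ∀ a b c d → a * (b * c * d) ≡ b * (a * (c * d))
  rearrange = ℕSolver.solve-∀

-- The multinomial formula with denominators cleared, so that the induction stays in ℕ. The three
-- blocks contribute `b`, `p` and `z` times `n !`, together `suc n * n !`.
length-words : ∀ {n} b p z → b + p + z ≡ n →
               length (words n (b , p , z)) * (b ! * p ! * z !) ≡ n !
length-words {zero} zero zero zero eq = refl
length-words {suc n} b p z eq = begin
  length (D ++ U ++ L) * (b ! * p ! * z !)
    ≡⟨ cong (_* (b ! * p ! * z !)) (trans (length-++ D) (cong₂ _+_ refl (length-++ U))) ⟩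
  (length D + (length U + length L)) * (b ! * p ! * z !)
    -- In each summand the factorial of the block's own letter moves to the front, as
    -- `length-prepend` expects.
    ≡⟨ distribute (length D) (length U) (length L) (b !) (p !) (z !) ⟩
  length D * (b ! * (p ! * z !)) + length U * (p ! * (b ! * z !)) + length L * (z ! * (b ! * p !))
    ≡⟨ cong₂ _+_ (cong₂ _+_
         (length-prepend down b (p ! * z !) λ { l refl → trans
           (assoc (length (words n (l , p , z))) (l !) (p !) (z !))
           (length-words l p z (suc-injective eq)) })
         (length-prepend up p (b ! * z !) λ { l refl → trans
           (swap (length (words n (b , l , z))) (l !) (b !) (z !))
           (length-words b l z (suc-injective (trans (sym (cong (_+ z) (+-suc b l))) eq))) }))
         (length-prepend level z (b ! * p !) λ { l refl → trans
           (cong (length (words n (b , p , l)) *_) (*-comm (l !) _))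
           (length-words b p l (suc-injective (trans (sym (+-suc (b + p) l)) eq))) }) ⟩
  b * n ! + p * n ! + z * n !
    ≡⟨ collect b p z (n !) ⟩
  (b + p + z) * n !
    ≡⟨ cong (_* n !) eq ⟩
  suc n * n ! ∎
  where
  open ≡-Reasoning
  D = prepend down  (λ k → words n (k , p , z)) b
  U = prepend up    (λ k → words n (b , k , z)) p
  L = prepend level (λ k → words n (b , p , k)) z
  distribute : ∀ d u l x y w → (d + (u + l)) * (x * y * w) ≡
               d * (x * (y * w)) + u * (y * (x * w)) + l * (w * (x * y))
  distribute = ℕSolver.solve-∀
  assoc : ∀ k x y w → k * (x * (y * w)) ≡ k * (x * y * w)
  assoc = ℕSolver.solve-∀
  swap : ∀ k x y w → k * (x * (y * w)) ≡ k * (y * x * w)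
  swap = ℕSolver.solve-∀
  collect : ∀ b p z f → b * f + p * f + z * f ≡ (b + p + z) * f
  collect = ℕSolver.solve-∀

-- Words with a given total

rise : Move → ℤ
rise down  = -1ℤ
rise level = 0ℤ
rise up    = 1ℤ

total : Vec Move n → ℤ
total []      = 0ℤ
total (m ∷ w) = rise m ℤ.+ total w

-- Put additively to avoid subtraction: a down move leaves the left side unchanged, an up move
-- raises both sides by one.
total-tally : (w : Vec Move n) → let (b , p , _) = tally w in total w ℤ.+ + b ≡ + p
total-tally []          = refl
total-tally (down ∷ w)  = trans (cancel (total w) (+ proj₁ (tally w))) (total-tally w)
  where
  cancel : ∀ x y → (-1ℤ ℤ.+ x) ℤ.+ (1ℤ ℤ.+ y) ≡ x ℤ.+ y
  cancel = ℤSolver.solve-∀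
total-tally (level ∷ w) = trans (cong (ℤ._+ + proj₁ (tally w)) (ℤ.+-identityˡ (total w))) (total-tally w)
total-tally (up ∷ w)    = trans (ℤ.+-assoc 1ℤ (total w) _) (cong ℤ.suc (total-tally w))

tally-size : (w : Vec Move n) → let (b , p , z) = tally w in b + p + z ≡ n
tally-size []          = refl
tally-size (down ∷ w)  = cong suc (tally-size w)
tally-size (up ∷ w)    = let (b , p , z) = tally w in
  trans (cong (_+ z) (+-suc b p)) (cong suc (tally-size w))
tally-size (level ∷ w) = let (b , p , z) = tally w in
  trans (+-suc (b + p) z) (cong suc (tally-size w))

-- Up moves first, then level ones. This later supplies a path of length `∣ i ∣`, against which
-- minimality is tested.
∃-total : ∀ {c n} → c ≤ n → Σ[ w ∈ Vec Move n ] total w ≡ + c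
∃-total {n = zero} z≤n = [] , refl
∃-total {n = suc n} z≤n with w , eq ← ∃-total {n = n} z≤n =
  level ∷ w , trans (ℤ.+-identityˡ (total w)) eq
∃-total (s≤s c≤n) with w , eq ← ∃-total c≤n = up ∷ w , cong ℤ.suc eq

-- Fixing the length `d` and the total `c` leaves the number `b` of down moves as the only free
-- parameter.
tallyOf : (d c b : ℕ) → Tally
tallyOf d c b = b , c + b , d ∸ c ∸ 2 * b

wordsWithTotal : (d c : ℕ) → List (Vec Move d)
wordsWithTotal d c = concatMap (words d ∘ tallyOf d c) (indices (d ∸ c))

indices-unique : ∀ e → Unique (indices e)
indices-unique e = Unique.filter⁺ (λ b → 2 * b ≤? e) (Unique.upTo⁺ (suc e))

∈-indices⁺ : ∀ {b e} → 2 * b ≤ e → b ∈ indices e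
∈-indices⁺ {b} {e} 2b≤e =
  ∈-filter⁺ (λ b → 2 * b ≤? e) (∈-upTo⁺ (s≤s (≤-trans (m≤m+n b _) 2b≤e))) 2b≤e

∈-indices⁻ : ∀ {b e} → b ∈ indices e → 2 * b ≤ e
∈-indices⁻ {e = e} b∈ = proj₂ (∈-filter⁻ (λ b → 2 * b ≤? e) {xs = upTo (suc e)} b∈)

regroup : ∀ b c z → b + (c + b) + z ≡ z + 2 * b + c
regroup = ℕSolver.solve-∀

tallyOf-total : ∀ {d c} (w : Vec Move d) → total w ≡ + c →
                let b = proj₁ (tally w) in 2 * b ≤ d ∸ c × tally w ≡ tallyOf d c b
tallyOf-total {d} {c} w tw with tally w | total-tally w | tally-size w
-- The total forces `p = c + b`; the size then gives `d ∸ c = z + 2 * b`, which yields both the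
-- bound on `b` and the value of `z`.
... | b , p , z | tt | size with refl ← ℤ.+-injective (trans (sym tt) (cong (ℤ._+ + b) tw)) =
  subst (2 * b ≤_) (sym d∸c) (m≤n+m (2 * b) z) ,
  cong (λ z → b , c + b , z) (sym (trans (cong (_∸ 2 * b) d∸c) (m+n∸n≡m z (2 * b))))
  where
  d∸c : d ∸ c ≡ z + 2 * b
  d∸c = trans (cong (_∸ c) (trans (sym size) (regroup b c z))) (m+n∸n≡m (z + 2 * b) c)

total-tallyOf : ∀ {d c} b (w : Vec Move d) → tally w ≡ tallyOf d c b → total w ≡ + c
total-tallyOf {d} {c} b w eq = ℤGroup.∙-cancelʳ (+ b) (total w) (+ c) (begin
  total w ℤ.+ + b                 ≡⟨ cong (λ t → total w ℤ.+ + proj₁ t) eq ⟨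
  total w ℤ.+ + proj₁ (tally w)   ≡⟨ total-tally w ⟩
  + proj₁ (proj₂ (tally w))       ≡⟨ cong (+_ ∘ proj₁ ∘ proj₂) eq ⟩
  + (c + b)                       ∎)
  where open ≡-Reasoning

∈-wordsWithTotal⁺ : ∀ {d c} {w : Vec Move d} → total w ≡ + c → w ∈ wordsWithTotal d c
∈-wordsWithTotal⁺ {d} {c} {w} tw with 2b≤ , eq ← tallyOf-total w tw =
  ∈-concatMap⁺ (words d ∘ tallyOf d c)
    (lose (∈-indices⁺ 2b≤) (subst (λ t → w ∈ words d t) eq (∈-words-tally w)))

∈-wordsWithTotal⁻ : ∀ {d c} {w : Vec Move d} → w ∈ wordsWithTotal d c → total w ≡ + c
∈-wordsWithTotal⁻ {d} {c} {w} w∈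
  with b , _ , w∈b ← find (∈-concatMap⁻ (words d ∘ tallyOf d c) {xs = indices (d ∸ c)} w∈) =
  total-tallyOf b w (tally-∈-words w∈b)

wordsWithTotal-unique : ∀ d c → Unique (wordsWithTotal d c)
wordsWithTotal-unique d c = Unique.concat⁺
  (All.map⁺ (All.universal (λ b → words-unique d (tallyOf d c b)) (indices (d ∸ c))))
  (AllPairs.map⁺ (AllPairs.map
    -- Different `b` give different tallies, since `b` is the first entry.
    (λ b≢b′ {_} → words-disjoint (b≢b′ ∘ cong proj₁))
    (indices-unique (d ∸ c))))

-- Rational sums of factorial quotients

-- Normalised fractions do not compute for variable numerators, so the identity is checked by
-- cross-multiplication of unnormalised ones.
/1-homo-+ : ∀ a b → (+ a) / 1 ℚ.+ (+ b) / 1 ≡ (+ (a + b)) / 1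
/1-homo-+ a b = ℚ.toℚᵘ-injective (begin
  ℚ.toℚᵘ ((+ a) / 1 ℚ.+ (+ b) / 1)           ≈⟨ ℚ.toℚᵘ-homo-+ ((+ a) / 1) ((+ b) / 1) ⟩
  ℚ.toℚᵘ ((+ a) / 1) ℚᵘ.+ ℚ.toℚᵘ ((+ b) / 1) ≈⟨ ℚᵘ.+-cong (ℚ.toℚᵘ-fromℚᵘ (ℚᵘ.mkℚᵘ (+ a) 0)) (ℚ.toℚᵘ-fromℚᵘ (ℚᵘ.mkℚᵘ (+ b) 0)) ⟩
  ℚᵘ.mkℚᵘ (+ a) 0 ℚᵘ.+ ℚᵘ.mkℚᵘ (+ b) 0       ≈⟨ ℚᵘ.*≡* (same (+ a) (+ b)) ⟩
  ℚᵘ.mkℚᵘ (+ (a + b)) 0                      ≈⟨ ℚ.toℚᵘ-fromℚᵘ (ℚᵘ.mkℚᵘ (+ (a + b)) 0) ⟨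
  ℚ.toℚᵘ ((+ (a + b)) / 1)                   ∎)
  where
  open ℚᵘ.≃-Reasoning
  same : ∀ x y → (x ℤ.* 1ℤ ℤ.+ y ℤ.* 1ℤ) ℤ.* 1ℤ ≡ (x ℤ.+ y) ℤ.* 1ℤ
  same = ℤSolver.solve-∀

/-exact : ∀ {m} k {q} .{{_ : NonZero q}} → k * q ≡ m → (+ k) / 1 ≡ (+ m) / q
/-exact k {suc q} refl =
  -- `mkℚᵘ` stores the denominator minus one: `0` stands for 1 and `q` for `suc q`.
  ℚ.fromℚᵘ-cong {ℚᵘ.mkℚᵘ (+ k) 0} {ℚᵘ.mkℚᵘ (+ (k * suc q)) q}
    (ℚᵘ.*≡* (trans (sym (ℤ.pos-* k (suc q))) (sym (ℤ.*-identityʳ _))))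

-- The two bounds make both truncated subtractions exact, so the tally adds up to `d` and
-- `length-words` applies.
length-words-term : ∀ {d c b} → c ≤ d → 2 * b ≤ d ∸ c →
                    (+ length (words d (tallyOf d c b))) / 1 ≡ term d c b
length-words-term {d} {c} {b} c≤d 2b≤ =
  /-exact (length (words d (tallyOf d c b))) (length-words b (c + b) z size)
  where
  z = d ∸ c ∸ 2 * b
  instance
    _ = b !≢0
    _ = (c + b) !≢0
    _ = z !≢0
    _ = m*n≢0 (b !) ((c + b) !)
    _ = m*n≢0 (b ! * (c + b) !) (z !)
  size : b + (c + b) + z ≡ d
  size = trans (regroup b c z) (trans (cong (_+ c) (m∸n+n≡m 2b≤)) (m∸n+n≡m c≤d))

length-concatMap : ∀ {A B : Set} (f : A → List B) (g : A → ℚ) {xs} →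
                   All (λ x → (+ length (f x)) / 1 ≡ g x) xs →
                   (+ length (concatMap f xs)) / 1 ≡ sumℚ (map g xs)
length-concatMap f g [] = refl
length-concatMap f g {x ∷ xs} (eq ∷ eqs) = begin
  (+ length (f x ++ concatMap f xs)) / 1                    ≡⟨ cong (λ k → (+ k) / 1) (length-++ (f x)) ⟩
  (+ (length (f x) + length (concatMap f xs))) / 1          ≡⟨ /1-homo-+ (length (f x)) _ ⟨
  (+ length (f x)) / 1 ℚ.+ (+ length (concatMap f xs)) / 1  ≡⟨ cong₂ ℚ._+_ eq (length-concatMap f g eqs) ⟩
  g x ℚ.+ sumℚ (map g xs)                                   ∎
  where open ≡-Reasoning

length-wordsWithTotal : ∀ {d c} → c ≤ d →
  (+ length (wordsWithTotal d c)) / 1 ≡ sumℚ (map (term d c) (indices (d ∸ c)))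
length-wordsWithTotal {d} {c} c≤d = length-concatMap (words d ∘ tallyOf d c) (term d c)
  (All.tabulate (λ b∈ → length-words-term c≤d (∈-indices⁻ b∈)))

-- Paths

IsPath-tail : ∀ {q p x} {r : Vec Point (suc n)} → IsPath q p (x ∷ r) → IsPath (Vec.lookup r zero) p r
IsPath-tail path = record { start = refl ; end = end ; step = step ∘ suc }
  where open IsPath path

-- Triangle inequality through the second point `q′`, using only the first coordinate of each step.
path-length-≥ : ∀ {q p} (r : Vec Point (suc n)) → IsPath q p r → ∣ proj₁ p ℤ.- proj₁ q ∣ ≤ n
path-length-≥ (x ∷ []) record { start = refl ; end = refl } =
  ≤-reflexive (cong ∣_∣ (ℤ.+-inverseʳ (proj₁ x)))
path-length-≥ {suc n} {q} {p} (q ∷ r@(q′ ∷ _)) path@record { start = refl } = begin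
  ∣ proj₁ p ℤ.- proj₁ q ∣
    ≡⟨ cong ∣_∣ (through (proj₁ q) (proj₁ q′) (proj₁ p)) ⟩
  ∣ (proj₁ p ℤ.- proj₁ q′) ℤ.- (proj₁ q ℤ.- proj₁ q′) ∣
    ≤⟨ ℤ.∣i-j∣≤∣i∣+∣j∣ (proj₁ p ℤ.- proj₁ q′) (proj₁ q ℤ.- proj₁ q′) ⟩
  ∣ proj₁ p ℤ.- proj₁ q′ ∣ + ∣ proj₁ q ℤ.- proj₁ q′ ∣
    ≤⟨ +-mono-≤ (path-length-≥ r (IsPath-tail path)) (m⊔n≤o⇒m≤o _ _ (IsPath.step path zero)) ⟩
  n + 1
    ≡⟨ +-comm n 1 ⟩
  suc n ∎
  where
  open ≤-Reasoning
  through : ∀ x y z → z ℤ.- x ≡ (z ℤ.- y) ℤ.- (x ℤ.- y)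
  through = ℤSolver.solve-∀

-- Steps relative to a sign

∣unit*∣ : ∀ s x → ∣ (s ◃ 1) ℤ.* x ∣ ≡ ∣ x ∣
∣unit*∣ s x = trans (ℤ.abs-* (s ◃ 1) x) (trans (cong (_* ∣ x ∣) (ℤ.abs-◃ s 1)) (*-identityˡ ∣ x ∣))

unit-* : ∀ i → (sign i ◃ 1) ℤ.* + ∣ i ∣ ≡ i
unit-* (+ n)    = ℤ.*-identityˡ (+ n)
unit-* -[1+ n ] = ℤ.-1*i≡-i (+ suc n)

-- The minus sign is there because `_∈N₈_` bounds the old coordinate minus the new one.
unit-difference : ∀ s δ → ∣ δ ∣ ≤ 1 → ∃[ m ] δ ≡ ℤ.- ((s ◃ 1) ℤ.* rise m)
unit-difference Sign.+ (+ 0)    _ = level , refl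
unit-difference Sign.+ (+ 1)    _ = down , refl
unit-difference Sign.+ -[1+ 0 ] _ = up , refl
unit-difference Sign.- (+ 0)    _ = level , refl
unit-difference Sign.- (+ 1)    _ = up , refl
unit-difference Sign.- -[1+ 0 ] _ = down , refl
unit-difference _ (+ suc (suc _)) (s≤s ())
unit-difference _ -[1+ suc _ ]    (s≤s ())

unit-step : ∀ s x x′ → ∣ x ℤ.- x′ ∣ ≤ 1 → ∃[ m ] x′ ≡ x ℤ.+ (s ◃ 1) ℤ.* rise m
unit-step s x x′ ≤1 with m , eq ← unit-difference s (x ℤ.- x′) ≤1 =
  m , trans (recover x x′) (trans (cong (λ δ → x ℤ.- δ) eq) (absorb x ((s ◃ 1) ℤ.* rise m)))
  where
  recover : ∀ x x′ → x′ ≡ x ℤ.- (x ℤ.- x′)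
  recover = ℤSolver.solve-∀
  absorb : ∀ x δ → x ℤ.- (ℤ.- δ) ≡ x ℤ.+ δ
  absorb = ℤSolver.solve-∀

-- The offset `x` cancels and the unit does not affect absolute values, so either direction reduces
-- to the positive one.
remaining-distance : ∀ s x {x′ i} a b → i ≡ x ℤ.+ (s ◃ 1) ℤ.* a → x′ ≡ x ℤ.+ (s ◃ 1) ℤ.* b →
                     ∣ i ℤ.- x′ ∣ ≡ ∣ a ℤ.- b ∣
remaining-distance s x a b refl refl =
  trans (cong ∣_∣ (factor x (s ◃ 1) a b)) (∣unit*∣ s (a ℤ.- b))
  where
  factor : ∀ x e a b → x ℤ.+ e ℤ.* a ℤ.- (x ℤ.+ e ℤ.* b) ≡ e ℤ.* (a ℤ.- b)
  factor = ℤSolver.solve-∀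

-- A level or down move would leave a distance of `n + 1` or `n + 2`.
approach⇒up : ∀ m → ∣ + suc n ℤ.- rise m ∣ ≤ n → m ≡ up
approach⇒up up    _ = refl
approach⇒up {n} level ≤n = ⊥-elim (<-irrefl refl (subst (λ k → suc k ≤ n) (+-identityʳ n) ≤n))
approach⇒up {n} down  ≤n = ⊥-elim (m+n≮m n 1 ≤n)

rise-injective : ∀ {m m′} → rise m ≡ rise m′ → m ≡ m′
rise-injective {down}  {down}  _ = refl
rise-injective {level} {level} _ = refl
rise-injective {up}    {up}    _ = refl

-- Paths traced by words of moves

module Traces (s t : Sign) where

  -- The letter steers the second coordinate only, with `up` meaning the direction of `t`. Working
  -- relative to `s` and `t` treats all quadrants at once.
  shift : Move → Point → Point
  shift m (x , y) = x ℤ.+ (s ◃ 1) , y ℤ.+ (t ◃ 1) ℤ.* rise m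

  trace : Point → Vec Move n → Vec Point (suc n)
  trace q []      = q ∷ []
  trace q (m ∷ w) = q ∷ trace (shift m q) w

  lookup-trace-zero : ∀ q (w : Vec Move n) → Vec.lookup (trace q w) zero ≡ q
  lookup-trace-zero q []      = refl
  lookup-trace-zero q (_ ∷ _) = refl

  lookup-trace-last : ∀ x y (w : Vec Move n) → Vec.lookup (trace (x , y) w) (fromℕ n) ≡
                      (x ℤ.+ (s ◃ 1) ℤ.* + n , y ℤ.+ (t ◃ 1) ℤ.* total w)
  lookup-trace-last x y [] = cong₂ _,_ (none x (s ◃ 1)) (none y (t ◃ 1))
    where
    none : ∀ x e → x ≡ x ℤ.+ e ℤ.* 0ℤ
    none = ℤSolver.solve-∀
  lookup-trace-last {suc n} x y (m ∷ w) = trans (lookup-trace-last _ _ w)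
    (cong₂ _,_ (one-more x (s ◃ 1) (+ n)) (more y (t ◃ 1) (rise m) (total w)))
    where
    one-more : ∀ x e k → x ℤ.+ e ℤ.+ e ℤ.* k ≡ x ℤ.+ e ℤ.* (1ℤ ℤ.+ k)
    one-more = ℤSolver.solve-∀
    more : ∀ y e a b → y ℤ.+ e ℤ.* a ℤ.+ e ℤ.* b ≡ y ℤ.+ e ℤ.* (a ℤ.+ b)
    more = ℤSolver.solve-∀

  shift-∈N₈ : ∀ m q → shift m q ∈N₈ q
  shift-∈N₈ m (x , y) = ⊔-lub
    (≤-reflexive (trans (distance x (s ◃ 1)) (ℤ.abs-◃ s 1)))
    (≤-trans (≤-reflexive (trans (distance y ((t ◃ 1) ℤ.* rise m)) (∣unit*∣ t (rise m)))) (∣rise∣≤1 m))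
    where
    distance : ∀ x δ → ∣ x ℤ.- (x ℤ.+ δ) ∣ ≡ ∣ δ ∣
    distance x δ = trans (cong ∣_∣ (cancel x δ)) (ℤ.∣-i∣≡∣i∣ δ)
      where
      cancel : ∀ x δ → x ℤ.- (x ℤ.+ δ) ≡ ℤ.- δ
      cancel = ℤSolver.solve-∀
    ∣rise∣≤1 : ∀ m → ∣ rise m ∣ ≤ 1
    ∣rise∣≤1 down  = ≤-refl
    ∣rise∣≤1 level = z≤n
    ∣rise∣≤1 up    = ≤-refl

  trace-step : ∀ q (w : Vec Move n) (k : Fin n) →
               Vec.lookup (trace q w) (suc k) ∈N₈ Vec.lookup (trace q w) (inject₁ k)
  trace-step q (m ∷ w) zero =
    subst (_∈N₈ q) (sym (lookup-trace-zero (shift m q) w)) (shift-∈N₈ m q)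
  trace-step q (m ∷ w) (suc k) = trace-step (shift m q) w k

  trace-isPath : ∀ x y (w : Vec Move n) →
    IsPath (x , y) (x ℤ.+ (s ◃ 1) ℤ.* + n , y ℤ.+ (t ◃ 1) ℤ.* total w) (trace (x , y) w)
  trace-isPath x y w = record
    { start = lookup-trace-zero (x , y) w
    ; end   = lookup-trace-last x y w
    ; step  = trace-step (x , y) w
    }

  unit*-injective : ∀ {a b} → (t ◃ 1) ℤ.* a ≡ (t ◃ 1) ℤ.* b → a ≡ b
  unit*-injective = ℤ.*-cancelˡ-≡ (t ◃ 1) _ _ {{ℤ.◃-nonZero t 1}}

  trace-injective : ∀ q {w v : Vec Move n} → trace q w ≡ trace q v → w ≡ v
  trace-injective q {[]} {[]} _ = refl
  trace-injective q {m ∷ w} {m′ ∷ v} eq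
    with eq′ ← ∷-injectiveʳ eq
    -- The first letter is read off from the second coordinate of the second point.
    with refl ← rise-injective {m} {m′} (unit*-injective (ℤGroup.∙-cancelˡ (proj₂ q) _ _ (cong proj₂
           (trans (sym (lookup-trace-zero (shift m q) w))
             (trans (cong (λ r → Vec.lookup r zero) eq′) (lookup-trace-zero (shift m′ q) v))))))
    = cong (m ∷_) (trace-injective (shift m q) eq′)

  -- A path whose length equals the horizontal distance has no slack: after any
  -- step other than the one towards the target, the target is out of reach.
  tight-path : ∀ {x y i j} (r : Vec Point (suc n)) → IsPath (x , y) (i , j) r →
               i ≡ x ℤ.+ (s ◃ 1) ℤ.* + n → ∃[ w ] r ≡ trace (x , y) w
  tight-path (_ ∷ []) record { start = refl } _ = [] , refl
  tight-path {suc n} {x} {y} {i} (_ ∷ r@((x′ , y′) ∷ _)) path@record { start = refl } i≡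
    -- The horizontal step is encoded as a `Move` too, relative to `s`, so that `up` means towards
    -- the target.
    with m  , x′≡  ← unit-step s x x′ (m⊔n≤o⇒m≤o _ _ (IsPath.step path zero))
       | m′ , refl ← unit-step t y y′ (m⊔n≤o⇒n≤o ∣ x ℤ.- x′ ∣ _ (IsPath.step path zero))
    -- The tail reaches the target in `n` steps, which bounds the remaining horizontal distance by
    -- `n`.
    with refl ← approach⇒up m (subst (_≤ n)
           (remaining-distance s x (+ suc n) (rise m) i≡ x′≡) (path-length-≥ r (IsPath-tail path)))
    with refl ← trans x′≡ (cong (λ e → x ℤ.+ e) (ℤ.*-identityʳ (s ◃ 1)))
    = let w , r≡ = tight-path r (IsPath-tail path) (trans i≡ (one-less x (s ◃ 1) (+ n)))
      in m′ ∷ w , cong ((x , y) ∷_) r≡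
    where
    one-less : ∀ x e k → x ℤ.+ e ℤ.* (1ℤ ℤ.+ k) ≡ x ℤ.+ e ℤ.+ e ℤ.* k
    one-less = ℤSolver.solve-∀

-- Counting by enumeration

lookup-injective : ∀ {A : Set} {xs : List A} → Unique xs →
                   ∀ k l → lookup xs k ≡ lookup xs l → k ≡ l
lookup-injective (_ ∷ _)   zero    zero    _  = refl
lookup-injective (x∉ ∷ _)  zero    (suc l) eq = ⊥-elim (All.lookup x∉ (∈-lookup l) eq)
lookup-injective (x∉ ∷ _)  (suc k) zero    eq = ⊥-elim (All.lookup x∉ (∈-lookup k) (sym eq))
lookup-injective (_ ∷ uxs) (suc k) (suc l) eq = cong suc (lookup-injective uxs k l eq)

-- The bijection sends an element to its position in the duplicate-free list. The setoid compares
-- first components only, so `P x` may have several proofs.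
enumeration⇒cardinality : ∀ {B : Set} {P : B → Set} (xs : List B) → Unique xs →
  (∀ {x} → x ∈ xs → P x) → (∀ {x} → P x → x ∈ xs) →
  HasCardinality (onSetoid {B = Σ[ x ∈ B ] P x} (setoid B) proj₁) (length xs)
enumeration⇒cardinality xs unique sound complete = record
  { to        = λ (_ , px) → index (complete px)
  ; from      = λ k → lookup xs k , sound (∈-lookup k)
  ; to-cong   = λ {(_ , px)} {(_ , py)} x≡y → lookup-injective unique _ _
                  (trans (sym (lookup-index (complete px))) (trans x≡y (lookup-index (complete py))))
  ; from-cong = λ { refl → refl }
  ; inverse   = (λ {k} {(_ , py)} y≡ → lookup-injective unique _ _
                  (trans (sym (lookup-index (complete py))) y≡))
              , (λ { {_ , px} refl → sym (lookup-index (complete px)) })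
  }

-- Shortest paths from the origin to `(i , j)`

module _ (i j : ℤ) where

  open Traces (sign i) (sign j)

  private
    O : Point
    O = 0ℤ , 0ℤ

    toSequence : Vec Move ∣ i ∣ → PointSequence
    toSequence w = ∣ i ∣ , trace O w

    -- Equality proofs in ℕ are unique, so an equality of pairs with the same length gives one of
    -- the vectors.
    toSequence-injective : ∀ {w v} → toSequence w ≡ toSequence v → w ≡ v
    toSequence-injective eq = trace-injective O (,-injectiveʳ-UIP ≡-irrelevant eq)

    target-x : 0ℤ ℤ.+ (sign i ◃ 1) ℤ.* + ∣ i ∣ ≡ i
    target-x = trans (ℤ.+-identityˡ _) (unit-* i)

    target-y : ∀ {c} → c ≡ + ∣ j ∣ → 0ℤ ℤ.+ (sign j ◃ 1) ℤ.* c ≡ j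
    target-y refl = trans (ℤ.+-identityˡ _) (unit-* j)

    length-≥ : ∀ {m} (r : Vec Point (suc m)) → IsPath O (i , j) r → ∣ i ∣ ≤ m
    length-≥ r path = subst (_≤ _) (cong ∣_∣ (ℤ.+-identityʳ i)) (path-length-≥ r path)

    trace-isPath-to : ∀ {w : Vec Move ∣ i ∣} → total w ≡ + ∣ j ∣ → IsPath O (i , j) (trace O w)
    trace-isPath-to {w} tw =
      subst (λ p → IsPath O p (trace O w)) (cong₂ _,_ target-x (target-y tw)) (trace-isPath 0ℤ 0ℤ w)

    -- Both sides, multiplied by the unit of `j`, are the second coordinate of the endpoint.
    isPath-to-trace : ∀ {w : Vec Move ∣ i ∣} → IsPath O (i , j) (trace O w) → total w ≡ + ∣ j ∣
    isPath-to-trace {w} path = unit*-injective (ℤGroup.∙-cancelˡ 0ℤ _ _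
      (trans (cong proj₂ (trans (sym (lookup-trace-last 0ℤ 0ℤ w)) (IsPath.end path)))
             (sym (target-y refl))))

  shortestPaths : List PointSequence
  shortestPaths = map toSequence (wordsWithTotal ∣ i ∣ ∣ j ∣)

  shortestPaths-unique : Unique shortestPaths
  shortestPaths-unique = Unique.map⁺ toSequence-injective (wordsWithTotal-unique ∣ i ∣ ∣ j ∣)

  ∈-shortestPaths⁻ : ∀ {r} → r ∈ shortestPaths → IsShortestPath O (i , j) (proj₂ r)
  ∈-shortestPaths⁻ r∈ with w , w∈ , refl ← ∈-map⁻ toSequence r∈ =
    trace-isPath-to (∈-wordsWithTotal⁻ w∈) , length-≥

  ∈-shortestPaths⁺ : ∣ j ∣ ≤ ∣ i ∣ → ∀ {r} → IsShortestPath O (i , j) (proj₂ r) → r ∈ shortestPaths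
  ∈-shortestPaths⁺ j≤i {n , r} (path , minimal)
    with v , tv ← ∃-total j≤i
    -- Comparing with the trace of `v` gives `n ≤ ∣ i ∣`; with the lower bound the length is exactly
    -- `∣ i ∣`, so `tight-path` applies.
    with refl ← ≤-antisym (minimal (trace O v) (trace-isPath-to tv)) (length-≥ r path)
    with w , refl ← tight-path r path (sym target-x) =
    ∈-map⁺ toSequence (∈-wordsWithTotal⁺ (isPath-to-trace path))

theorem5p1 : (i j : ℤ) → ∣ i ∣ ≥ ∣ j ∣ →
    Σ[ f₈ ∈ ℕ ] (HasCardinality (ShortestPaths (0ℤ , 0ℤ) (i , j)) f₈
    × (+ f₈) / 1 ≡ f₈-formula i j)
theorem5p1 i j j≤i =
  length (shortestPaths i j) ,
  enumeration⇒cardinality (shortestPaths i j) (shortestPaths-unique i j)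
    (∈-shortestPaths⁻ i j) (∈-shortestPaths⁺ i j j≤i) ,
  trans (cong (λ k → (+ k) / 1) (length-map _ (wordsWithTotal ∣ i ∣ ∣ j ∣))) (length-wordsWithTotal j≤i)
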